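{- Let $G$ and $X$ be partial cubes. If both $G$ and $X$ are opposite-semicube-isomorphic, then the Cartesian product $Y=G\,\square\,X$ is also opposite-semicube-isomorphic.
   Context: All graphs are undirected, connected, simple and finite; $d_G$ is the usual shortest-path distance. The Cartesian product $G\,\square\,X$ has vertex set $V(G)\times V(X)$, with $(g,h)$ adjacent to $(g',h')$ iff either $gg'\in E(G)$ and $h=h'$, or $g=g'$ and $hh'\in E(X)$. A partial cube is a graph isomorphic to an isometric subgraph of some hypercube (a subgraph $H$ of $Q$ is isometric if $d_H(x,y)=d_Q(x,y)$ for all $x,y\in V(H)$); the Cartesian product of two partial cubes is a partial cube. The Djokovi\'c–Winkler relation on $E(G)$ is: $uv\,\Theta\,xy$ iff $d_G(u,x)+d_G(v,y)\ne d_G(u,y)+d_G(v,x)$; in a partial cube it is an equivalence relation, and its classes $E_1,\dots,E_d$ are the $\Theta$-classes. For a $\Theta$-class $E_i$ and an edge $xy\in E_i$, the two (opposite) semicubes associated with $E_i$ are $W_i^0=\{a\in V(G): d_G(x,a)<d_G(y,a)\}$ and $W_i^1=\{a\in V(G): d_G(y,a)<d_G(x,a)\}$ (independent of the choice of $xy\in E_i$ up to interchanging the labels $0,1$). A partial cube $G$ is opposite-semicube-isomorphic if $G[W_i^0]\cong G[W_i^1]$ (induced subgraphs) for every $i\in\{1,\dots,d\}$. -}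

module Defs where

open import Level using (0ℓ)
open import Data.Bool using (Bool)
import Data.Bool.Properties as Bool
open import Data.Empty using (⊥-elim)
open import Data.Fin using (Fin; zero; suc)
import Data.Fin.Properties as Fin
open import Data.Nat using (ℕ; zero; suc; _+_; _*_; _^_; _≤_; _<_; z≤n; s≤s)
open import Data.Product using (Σ; ∃-syntax; _×_; _,_; proj₁; proj₂)
open import Data.Product.Function.NonDependent.Propositional using (_×-↔_)
open import Data.Refinement using (Refinement; value)
open import Data.Sum using (_⊎_; inj₁; inj₂)
open import Data.Vec using (Vec; []; _∷_; lookup)
open import Function using (_∘_; Injective)
open import Function.Bundles using (_↔_; _⇔_; Inverse; mk↔ₛ′)
open import Function.Construct.Composition using (_↔-∘_)
open import Function.Properties.Inverse using (↔-sym; ↔⇒↣)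
open import Relation.Binary using (Rel; Decidable; DecidableEquality; Symmetric)
open import Relation.Binary.PropositionalEquality
  using (_≡_; _≢_; refl; sym; cong; subst)
open import Relation.Nullary using (¬_; Dec; yes; no)
open import Relation.Nullary.Decidable using (map′; _×-dec_; _⊎-dec_; _→-dec_; ¬?)
open import Relation.Unary using (Pred; _∈_)

-- The edge relation is read as a mere relation: different proofs of E u v
-- denote the same edge.
record SimpleGraph : Set₁ where
  field
    V        : Set
    E        : Rel V 0ℓ
    E-sym    : Symmetric E
    E-irrefl : ∀ {v} → ¬ E v v

-- Walk G u v n: there is a walk from u to v with exactly n edges.
data Walk (G : SimpleGraph) : (u v : SimpleGraph.V G) → ℕ → Set where
  stop : ∀ {u} → Walk G u u zero
  step : ∀ {u w v n} → SimpleGraph.E G u w → Walk G w v n → Walk G u v (suc n)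

-- A finite connected simple graph.  Decidability of E is what finiteness
-- of the edge set amounts to constructively.
record Graph : Set₁ where
  field
    simple    : SimpleGraph
  open SimpleGraph simple public
  field
    order     : ℕ
    finite    : V ↔ Fin order
    E?        : Decidable E
    connected : ∀ u v → ∃[ n ] Walk simple u v n

  infix 4 _≟V_
  _≟V_ : DecidableEquality V
  _≟V_ = Fin.inj⇒≟ (↔⇒↣ finite)

open Graph using (simple; V; E)

private
  least : {P : Pred ℕ 0ℓ} → (∀ n → Dec (P n)) → ∀ n → P n →
          ∃[ m ] P m × (∀ k → P k → m ≤ k)
  least P? n p with P? zero
  least P? n       p | yes p₀ = zero , p₀ , λ _ _ → z≤n
  least P? zero    p | no ¬p₀ = ⊥-elim (¬p₀ p)
  least P? (suc n) p | no ¬p₀ with least (P? ∘ suc) n p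
  ... | m , pm , min = suc m , pm , λ where
    zero    p₀ → ⊥-elim (¬p₀ p₀)
    (suc k) pk → s≤s (min k pk)

  walk? : (G : Graph) (u v : V G) (n : ℕ) → Dec (Walk (simple G) u v n)
  walk? G u v zero = map′ (λ { refl → stop }) (λ { stop → refl }) (u ≟V v)
    where open Graph G using (_≟V_)
  walk? G u v (suc n) = map′
      (λ { (_ , e , w) → step e w })
      (λ { (step {w = x} e w) →
             to x , subst (λ y → E G u y × Walk (simple G) y v n)
                          (sym (strictlyInverseʳ x)) (e , w) })
      (Fin.any? (λ i → Graph.E? G u (from i) ×-dec walk? G (from i) v n))
    where open Inverse (Graph.finite G) using (to; from; strictlyInverseʳ)

shortestWalk : (G : Graph) (u v : V G) →
  ∃[ n ] Walk (simple G) u v n × (∀ m → Walk (simple G) u v m → n ≤ m)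
shortestWalk G u v with Graph.connected G u v
... | n , w = least (walk? G u v) n w

d : (G : Graph) → V G → V G → ℕ
d G u v = proj₁ (shortestWalk G u v)

infix 4 _≅_
record _≅_ (G H : SimpleGraph) : Set where
  private
    module G = SimpleGraph G
    module H = SimpleGraph H
  field
    bijection : G.V ↔ H.V
  open Inverse bijection public using (to; from)
  field
    E⇔E : ∀ u v → G.E u v ⇔ H.E (to u) (to v)

-- Vertices of the induced subgraph are pairs whose membership proof is
-- irrelevant, so they are equal as soon as the underlying vertices are.
infix 10 _[_]
_[_] : (G : Graph) → Pred (V G) 0ℓ → SimpleGraph
G [ W ] = record
  { V        = Refinement (V G) W
  ; E        = λ a b → E G (value a) (value b)
  ; E-sym    = Graph.E-sym G
  ; E-irrefl = Graph.E-irrefl G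
  }

mapWalk : (G H : SimpleGraph) (f : SimpleGraph.V G → SimpleGraph.V H) →
          (∀ {u v} → SimpleGraph.E G u v → SimpleGraph.E H (f u) (f v)) →
          ∀ {u v n} → Walk G u v n → Walk H (f u) (f v) n
mapWalk G H f hom stop       = stop
mapWalk G H f hom (step e w) = step (hom e) (mapWalk G H f hom w)

_++ʷ_ : ∀ {G u v w m n} → Walk G u v m → Walk G v w n → Walk G u w (m + n)
stop     ++ʷ q = q
step e p ++ʷ q = step e (p ++ʷ q)

infixr 7 _□_
_□_ : Graph → Graph → Graph
G □ X = record
  { simple    = Y
  ; order     = Graph.order G * Graph.order X
  ; finite    = ↔-sym Fin.*↔× ↔-∘ (Graph.finite G ×-↔ Graph.finite X)
  ; E?        = λ (g , h) (g′ , h′) →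
                  (Graph.E? G g g′ ×-dec Graph._≟V_ X h h′)
                  ⊎-dec (Graph._≟V_ G g g′ ×-dec Graph.E? X h h′)
  ; connected = λ (g , h) (g′ , h′) →
                  _ , (mapWalk (simple G) Y (_, h) (λ e → inj₁ (e , refl))
                               (proj₂ (Graph.connected G g g′))
                       ++ʷ
                       mapWalk (simple X) Y (g′ ,_) (λ e → inj₂ (refl , e))
                               (proj₂ (Graph.connected X h h′)))
  }
  where
  Y : SimpleGraph
  Y = record
    { V        = V G × V X
    ; E        = λ (g , h) (g′ , h′) →
                   (E G g g′ × h ≡ h′) ⊎ (g ≡ g′ × E X h h′)
    ; E-sym    = λ { (inj₁ (e , q)) → inj₁ (Graph.E-sym G e , sym q)
                   ; (inj₂ (p , e)) → inj₂ (sym p , Graph.E-sym X e) }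
    ; E-irrefl = λ { (inj₁ (e , _)) → Graph.E-irrefl G e
                   ; (inj₂ (_ , e)) → Graph.E-irrefl X e }
    }

DifferInOneBit : ∀ {k} → Rel (Vec Bool k) 0ℓ
DifferInOneBit {k} u v =
  ∃[ i ] lookup u i ≢ lookup v i × (∀ j → j ≢ i → lookup u j ≡ lookup v j)

private
  Vec-finite : ∀ k → Vec Bool k ↔ Fin (2 ^ k)
  Vec-finite zero    = mk↔ₛ′ (λ _ → zero) (λ _ → []) (λ { zero → refl }) (λ { [] → refl })
  Vec-finite (suc k) =
    ↔-sym Fin.*↔× ↔-∘ ((↔-sym Fin.2↔Bool ×-↔ Vec-finite k) ↔-∘ uncons↔)
    where
    uncons↔ : Vec Bool (suc k) ↔ (Bool × Vec Bool k)
    uncons↔ = mk↔ₛ′ (λ { (b ∷ u) → b , u }) (λ (b , u) → b ∷ u)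
                    (λ _ → refl) (λ { (_ ∷ _) → refl })

  cube : ℕ → SimpleGraph
  cube k = record
    { V        = Vec Bool k
    ; E        = DifferInOneBit
    ; E-sym    = λ (i , ne , eq) → i , ne ∘ sym , λ j j≢i → sym (eq j j≢i)
    ; E-irrefl = λ (_ , ne , _) → ne refl
    }

  cube-connected : ∀ k (u v : Vec Bool k) → ∃[ n ] Walk (cube k) u v n
  cube-connected zero    []      []      = zero , stop
  cube-connected (suc k) (a ∷ u) (b ∷ v) with cube-connected k u v
  ... | n , w with mapWalk (cube k) (cube (suc k)) (a ∷_) cons w
    where
    cons : ∀ {x y} → DifferInOneBit x y → DifferInOneBit (a ∷ x) (a ∷ y)
    cons (i , ne , eq) = suc i , ne , λ where
      zero    _   → refl
      (suc j) j≢i → eq j (j≢i ∘ cong suc)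
  ... | w′ with a Bool.≟ b
  ... | yes refl = n , w′
  ... | no  a≢b  = n + 1 , (w′ ++ʷ step (zero , a≢b , flipped) stop)
    where
    flipped : ∀ j → j ≢ zero → lookup (a ∷ v) j ≡ lookup (b ∷ v) j
    flipped zero    j≢0 = ⊥-elim (j≢0 refl)
    flipped (suc j) _   = refl

hypercube : ℕ → Graph
hypercube k = record
  { simple    = cube k
  ; order     = 2 ^ k
  ; finite    = Vec-finite k
  ; E?        = λ u v → Fin.any? λ i →
                  ¬? (lookup u i Bool.≟ lookup v i)
                  ×-dec Fin.all? λ j →
                    ¬? (j Fin.≟ i) →-dec (lookup u j Bool.≟ lookup v j)
  ; connected = cube-connected k
  }

-- A subgraph, not necessarily induced; the vertex subset is given by its
-- inclusion map.
record Subgraph (Q : Graph) : Set₁ where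
  field
    graph       : Graph
    ι           : V graph → V Q
    ι-injective : Injective _≡_ _≡_ ι
    ι-E         : ∀ {u v} → E graph u v → E Q (ι u) (ι v)

IsIsometric : {Q : Graph} → Subgraph Q → Set
IsIsometric {Q} H = ∀ x y → d graph x y ≡ d Q (ι x) (ι y)
  where open Subgraph H

IsPartialCube : Graph → Set₁
IsPartialCube G =
  ∃[ k ] Σ (Subgraph (hypercube k)) λ H →
    IsIsometric H × simple G ≅ simple (Subgraph.graph H)

-- Edges come with an orientation.  Reversing one does not affect Θ below, and
-- interchanges W⁰ and W¹.
record Edge (G : Graph) : Set where
  field
    x y : V G
    adj : E G x y

Θ : (G : Graph) → Rel (Edge G) 0ℓ
Θ G e f = d G u x + d G v y ≢ d G u y + d G v x
  where
  open Edge e renaming (x to u; y to v)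
  open Edge f

-- The Θ-class of a given edge.  When Θ is an equivalence relation, as in a
-- partial cube, every Θ-class arises in this way.
Θ-class : (G : Graph) → Edge G → Pred (Edge G) 0ℓ
Θ-class G e f = Θ G e f

W⁰ W¹ : (G : Graph) → Edge G → Pred (V G) 0ℓ
W⁰ G e a = d G (Edge.x e) a < d G (Edge.y e) a
W¹ G e a = d G (Edge.y e) a < d G (Edge.x e) a

-- The classes are indexed by a representative i, and e ranges over the edges
-- that may be used to define the semicubes of that class.
OppositeSemicubeIsomorphic : Graph → Set₁
OppositeSemicubeIsomorphic G =
  IsPartialCube G ×
  (∀ (i e : Edge G) → e ∈ Θ-class G i → G [ W⁰ G e ] ≅ G [ W¹ G e ])

{-# OPTIONS --safe #-}
module Submission where

-- Distances in a Cartesian product add up coordinatewise.  Hence, for an edge of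
-- G □ X lying over an edge e of G, whether (g , h) is nearer to one end than to
-- the other does not depend on h, so its semicubes are W⁰ G e □ X and W¹ G e □ X,
-- and an isomorphism between the factors extends to the products; edges lying
-- over X are symmetric.  The product of isometric embeddings into two hypercubes
-- is isometric because Q_k □ Q_l ≅ Q_{k+l} by concatenation.

open import Defs

open import Level using (0ℓ)
import Data.Irrelevant as Irrelevant
open import Data.Bool using (Bool)
open import Data.Fin using (splitAt; _↑ˡ_; _↑ʳ_)
open import Data.Fin.Properties
  using (splitAt-↑ˡ; splitAt-↑ʳ; splitAt⁻¹-↑ˡ; splitAt⁻¹-↑ʳ; ↑ˡ-injective; ↑ʳ-injective)
open import Data.Nat using (ℕ; suc; _+_; _≤_; _<_; z≤n)
open import Data.Nat.Properties
  using ( ≤-antisym; +-suc; m+n≡0⇒m≡0; +-mono-≤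
        ; +-cancelˡ-<; +-cancelʳ-<; +-monoˡ-<; +-monoʳ-<)
open import Data.Product using (∃-syntax; _×_; _,_; proj₁; proj₂)
open import Data.Product.Function.NonDependent.Propositional using (_×-↔_; _×-⇔_)
open import Data.Refinement using (_,_; value; value-injective)
open import Data.Sum using (_⊎_; inj₁; inj₂)
import Data.Sum as Sum
open import Data.Sum.Function.Propositional using (_⊎-⇔_)
open import Data.Vec using (Vec; _++_; lookup; take; drop)
open import Data.Vec.Properties
  using (lookup-++ˡ; lookup-++ʳ; take++drop≡id; ++-injective; tabulate∘lookup; tabulate-cong)
open import Function using (_∘_; Injective)
open import Function.Bundles using (_↔_; _⇔_; mk⇔; mk↔ₛ′; Inverse; Injection; Equivalence)
open import Function.Construct.Composition using (_↔-∘_; _⇔-∘_)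
open import Function.Construct.Identity using (↔-id; ⇔-id)
open import Function.Construct.Symmetry using (⇔-sym)
open import Function.Properties.Inverse using (↔-sym; ↔⇒↣)
open import Relation.Binary.PropositionalEquality
  using (_≡_; _≢_; refl; sym; trans; cong; cong₂; subst; subst₂; module ≡-Reasoning)
open import Relation.Unary using (Pred)

open Graph using (simple; V; E)
open Equivalence using () renaming (to to ⇒; from to ⇐)

-- Isomorphisms of simple graphs and of their products.

injective : {A B : Set} (f : A ↔ B) → Injective _≡_ _≡_ (Inverse.to f)
injective f = Injection.injective (↔⇒↣ f)

≅-refl : ∀ {G} → G ≅ G
≅-refl = record { bijection = ↔-id _ ; E⇔E = λ _ _ → ⇔-id _ }

≅-sym : ∀ {G H} → G ≅ H → H ≅ G
≅-sym {G} {H} φ = record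
  { bijection = ↔-sym φ.bijection
  ; E⇔E       = λ u v →
      subst₂ (λ u′ v′ → SimpleGraph.E H u′ v′ ⇔ SimpleGraph.E G (φ.from u) (φ.from v))
             (strictlyInverseˡ u) (strictlyInverseˡ v)
             (⇔-sym (φ.E⇔E (φ.from u) (φ.from v)))
  }
  where
  module φ = _≅_ φ
  open Inverse φ.bijection using (strictlyInverseˡ)

≅-trans : ∀ {G H K} → G ≅ H → H ≅ K → G ≅ K
≅-trans φ ψ = record
  { bijection = ψ.bijection ↔-∘ φ.bijection
  ; E⇔E       = λ u v → ψ.E⇔E (φ.to u) (φ.to v) ⇔-∘ φ.E⇔E u v
  }
  where
  module φ = _≅_ φ
  module ψ = _≅_ ψ

infixr 7 _□ₛ_
-- An induced subgraph `G [ W ]` is only a `SimpleGraph`, without finiteness or connectedness data,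
-- so `_□_` cannot take it as a factor.
_□ₛ_ : SimpleGraph → SimpleGraph → SimpleGraph
G □ₛ X = record
  { V        = G.V × X.V
  ; E        = λ (g , h) (g′ , h′) → (G.E g g′ × h ≡ h′) ⊎ (g ≡ g′ × X.E h h′)
  ; E-sym    = Sum.map (λ (e , q) → G.E-sym e , sym q) (λ (p , e) → sym p , X.E-sym e)
  ; E-irrefl = Sum.[ G.E-irrefl ∘ proj₁ , X.E-irrefl ∘ proj₂ ]
  }
  where
  module G = SimpleGraph G
  module X = SimpleGraph X

□ₛ-cong : ∀ {G H X Y} → G ≅ H → X ≅ Y → G □ₛ X ≅ H □ₛ Y
□ₛ-cong φ ψ = record
  { bijection = φ.bijection ×-↔ ψ.bijection
  ; E⇔E       = λ (g , h) (g′ , h′) →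
      (φ.E⇔E g g′ ×-⇔ mk⇔ (cong ψ.to) (injective ψ.bijection))
      ⊎-⇔ (mk⇔ (cong φ.to) (injective φ.bijection) ×-⇔ ψ.E⇔E h h′)
  }
  where
  module φ = _≅_ φ
  module ψ = _≅_ ψ

-- Vertices and edges agree definitionally; only the proofs of symmetry and irreflexivity are
-- written differently.
□≅□ₛ : (G X : Graph) → simple (G □ X) ≅ simple G □ₛ simple X
□≅□ₛ G X = record { bijection = ↔-id _ ; E⇔E = λ _ _ → ⇔-id _ }

-- Distances under isomorphisms and in products.

d-walk : (G : Graph) (u v : V G) → Walk (simple G) u v (d G u v)
d-walk G u v = proj₁ (proj₂ (shortestWalk G u v))

d-min : (G : Graph) {u v : V G} {n : ℕ} → Walk (simple G) u v n → d G u v ≤ n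
d-min G {u} {v} w = proj₂ (proj₂ (shortestWalk G u v)) _ w

d-refl : (G : Graph) (u : V G) → d G u u ≡ 0
d-refl G u = ≤-antisym (d-min G stop) z≤n

d≡0⇒≡ : (G : Graph) {u v : V G} → d G u v ≡ 0 → u ≡ v
-- Abstracting the distance together with its walk lets `p` fix the length as 0, which leaves only
-- `stop`.
d≡0⇒≡ G {u} {v} p with d G u v | d-walk G u v
d≡0⇒≡ G refl | .0 | stop = refl

d-hom-≤ : (G H : Graph) (f : V G → V H) → (∀ {u v} → E G u v → E H (f u) (f v)) →
          ∀ u v → d H (f u) (f v) ≤ d G u v
d-hom-≤ G H f hom u v = d-min H (mapWalk (simple G) (simple H) f hom (d-walk G u v))

-- Homomorphisms do not increase distances, and both directions of an isomorphism are homomorphisms.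
d-≅ : (G H : Graph) (φ : simple G ≅ simple H) (u v : V G) →
      d G u v ≡ d H (_≅_.to φ u) (_≅_.to φ v)
d-≅ G H φ u v = ≤-antisym
  (subst₂ (λ u′ v′ → d G u′ v′ ≤ d H (φ.to u) (φ.to v))
          (strictlyInverseʳ u) (strictlyInverseʳ v)
          (d-hom-≤ H G φ.from (⇒ (φ⁻¹.E⇔E _ _)) (φ.to u) (φ.to v)))
  (d-hom-≤ G H φ.to (⇒ (φ.E⇔E _ _)) u v)
  where
  module φ = _≅_ φ
  module φ⁻¹ = _≅_ (≅-sym φ)
  open Inverse φ.bijection using (strictlyInverseʳ)

-- Each step of a product walk moves in exactly one coordinate, so it is charged to exactly one of
-- the two projected walks.
unzipWalk : (G X : Graph) → ∀ {g h g′ h′ n} →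
  Walk (simple (G □ X)) (g , h) (g′ , h′) n →
  ∃[ m ] ∃[ k ] Walk (simple G) g g′ m × Walk (simple X) h h′ k × m + k ≡ n
unzipWalk G X stop = _ , _ , stop , stop , refl
unzipWalk G X (step (inj₁ (e , refl)) w) with unzipWalk G X w
... | _ , _ , p , q , eq = _ , _ , step e p , q , cong suc eq
unzipWalk G X (step (inj₂ (refl , e)) w) with unzipWalk G X w
... | m , k , p , q , eq = _ , _ , p , step e q , trans (+-suc m k) (cong suc eq)

-- For the upper bound, traverse a shortest walk in each factor, one after the other. For the lower
-- bound, project a shortest walk of the product to both factors.
d-□ : (G X : Graph) (g g′ : V G) (h h′ : V X) →
      d (G □ X) (g , h) (g′ , h′) ≡ d G g g′ + d X h h′
d-□ G X g g′ h h′ = ≤-antisym (d-min (G □ X) zipped) bound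
  where
  zipped : Walk (simple (G □ X)) (g , h) (g′ , h′) (d G g g′ + d X h h′)
  zipped = mapWalk (simple G) (simple (G □ X)) (_, h) (λ e → inj₁ (e , refl)) (d-walk G g g′)
           ++ʷ
           mapWalk (simple X) (simple (G □ X)) (g′ ,_) (λ e → inj₂ (refl , e)) (d-walk X h h′)

  bound : d G g g′ + d X h h′ ≤ d (G □ X) (g , h) (g′ , h′)
  bound with unzipWalk G X (d-walk (G □ X) (g , h) (g′ , h′))
  ... | m , k , p , q , eq = subst (d G g g′ + d X h h′ ≤_) eq (+-mono-≤ (d-min G p) (d-min X q))

-- Concatenation of bit vectors and products of partial cubes.

lookup-ext : ∀ {n} {u v : Vec Bool n} → (∀ i → lookup u i ≡ lookup v i) → u ≡ v
lookup-ext {u = u} {v} eq =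
  trans (sym (tabulate∘lookup u)) (trans (tabulate-cong eq) (tabulate∘lookup v))

↑ˡ≢↑ʳ : ∀ {m n} {i} {j} → i ↑ˡ n ≢ m ↑ʳ j
↑ˡ≢↑ʳ {m} {n} {i} {j} eq
  with () ← trans (sym (splitAt-↑ˡ m i n)) (trans (cong (splitAt m) eq) (splitAt-↑ʳ m n j))

module _ {k l} (u v : Vec Bool k) (w z : Vec Bool l) where

  lookup-≡-↑ˡ : ∀ i → lookup u i ≡ lookup v i ⇔
                lookup (u ++ w) (i ↑ˡ l) ≡ lookup (v ++ z) (i ↑ˡ l)
  lookup-≡-↑ˡ i rewrite lookup-++ˡ u w i | lookup-++ˡ v z i = ⇔-id _

  lookup-≡-↑ʳ : ∀ i → lookup w i ≡ lookup z i ⇔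
                lookup (u ++ w) (k ↑ʳ i) ≡ lookup (v ++ z) (k ↑ʳ i)
  lookup-≡-↑ʳ i rewrite lookup-++ʳ u w i | lookup-++ʳ v z i = ⇔-id _

  -- Below, `P` says that a position is not the flipped one, so that each half can be treated
  -- separately.
  lookup-≡-++ : {P : Pred _ 0ℓ} →
    (∀ i → P (i ↑ˡ l) → lookup u i ≡ lookup v i) →
    (∀ i → P (k ↑ʳ i) → lookup w i ≡ lookup z i) →
    ∀ j → P j → lookup (u ++ w) j ≡ lookup (v ++ z) j
  lookup-≡-++ eqˡ eqʳ j pj with splitAt k j in s
  ... | inj₁ i with refl ← splitAt⁻¹-↑ˡ {i = j} s = ⇒ (lookup-≡-↑ˡ i) (eqˡ i pj)
  ... | inj₂ i with refl ← splitAt⁻¹-↑ʳ {i = j} s = ⇒ (lookup-≡-↑ʳ i) (eqʳ i pj)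

  -- The half containing the single differing position tells which factor the edge moves in; the
  -- other halves agree everywhere.
  DifferInOneBit-++ : ((DifferInOneBit u v × w ≡ z) ⊎ (u ≡ v × DifferInOneBit w z)) ⇔
                      DifferInOneBit (u ++ w) (v ++ z)
  DifferInOneBit-++ = mk⇔ join split
    where
    join : (DifferInOneBit u v × w ≡ z) ⊎ (u ≡ v × DifferInOneBit w z) →
           DifferInOneBit (u ++ w) (v ++ z)
    join (inj₁ ((i , ne , eq) , w≡z)) =
      i ↑ˡ l , ne ∘ ⇐ (lookup-≡-↑ˡ i) ,
      lookup-≡-++ (λ j j≢i → eq j (j≢i ∘ cong (_↑ˡ l))) (λ j _ → cong (λ x → lookup x j) w≡z)
    join (inj₂ (u≡v , (i , ne , eq))) =
      k ↑ʳ i , ne ∘ ⇐ (lookup-≡-↑ʳ i) ,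
      lookup-≡-++ (λ j _ → cong (λ x → lookup x j) u≡v) (λ j j≢i → eq j (j≢i ∘ cong (k ↑ʳ_)))

    split : DifferInOneBit (u ++ w) (v ++ z) →
            (DifferInOneBit u v × w ≡ z) ⊎ (u ≡ v × DifferInOneBit w z)
    split (i , ne , eq) with splitAt k i in s
    ... | inj₁ i′ with refl ← splitAt⁻¹-↑ˡ {i = i} s = inj₁
      ( (i′ , ne ∘ ⇒ (lookup-≡-↑ˡ i′)
            , λ j j≢i → ⇐ (lookup-≡-↑ˡ j) (eq (j ↑ˡ l) (j≢i ∘ ↑ˡ-injective l j i′)))
      -- No position of the second half is the differing one, so the second halves coincide.
      , lookup-ext (λ j → ⇐ (lookup-≡-↑ʳ j) (eq (k ↑ʳ j) (↑ˡ≢↑ʳ ∘ sym))))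
    ... | inj₂ i′ with refl ← splitAt⁻¹-↑ʳ {i = i} s = inj₂
      ( lookup-ext (λ j → ⇐ (lookup-≡-↑ˡ j) (eq (j ↑ˡ l) ↑ˡ≢↑ʳ))
      , (i′ , ne ∘ ⇒ (lookup-≡-↑ʳ i′)
            , λ j j≢i → ⇐ (lookup-≡-↑ʳ j) (eq (k ↑ʳ j) (j≢i ∘ ↑ʳ-injective k j i′))))

hypercube-+ : ∀ k l → simple (hypercube k □ hypercube l) ≅ simple (hypercube (k + l))
hypercube-+ k l = record
  { bijection = mk↔ₛ′ (λ (u , v) → u ++ v) (λ w → take k w , drop k w) (take++drop≡id k)
      -- Both `take k` and `drop k` of `u ++ v` reassemble to `u ++ v`, so injectivity of
      -- concatenation recovers each half.
      (λ (u , v) → let p , q = ++-injective (take k (u ++ v)) u (take++drop≡id k (u ++ v))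
                   in cong₂ _,_ p q)
  ; E⇔E       = λ (u , w) (v , z) → DifferInOneBit-++ u v w z
  }

□-isPartialCube : (G X : Graph) → IsPartialCube G → IsPartialCube X → IsPartialCube (G □ X)
□-isPartialCube G X (k , H , H-isometric , φ) (l , K , K-isometric , ψ) =
  k + l , HK , HK-isometric ,
  ≅-trans (□≅□ₛ G X) (≅-trans (□ₛ-cong φ ψ) (≅-sym (□≅□ₛ H.graph K.graph)))
  where
  module H = Subgraph H
  module K = Subgraph K
  module ++≅ = _≅_ (hypercube-+ k l)

  HK : Subgraph (hypercube (k + l))
  HK = record
    { graph       = H.graph □ K.graph
    ; ι           = λ (a , b) → H.ι a ++ K.ι b
    ; ι-injective = λ {(a , b)} {(a′ , b′)} eq →
        let p , q = ++-injective (H.ι a) (H.ι a′) eq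
        in cong₂ _,_ (H.ι-injective p) (K.ι-injective q)
    ; ι-E         = λ e → ⇒ (++≅.E⇔E _ _)
        (Sum.map (λ (e , q) → H.ι-E e , cong K.ι q) (λ (p , e) → cong H.ι p , K.ι-E e) e)
    }

  HK-isometric : IsIsometric HK
  HK-isometric (a , b) (a′ , b′) = begin
    d (H.graph □ K.graph) (a , b) (a′ , b′)
      ≡⟨ d-□ H.graph K.graph a a′ b b′ ⟩
    d H.graph a a′ + d K.graph b b′
      ≡⟨ cong₂ _+_ (H-isometric a a′) (K-isometric b b′) ⟩
    d (hypercube k) (H.ι a) (H.ι a′) + d (hypercube l) (K.ι b) (K.ι b′)
      ≡⟨ d-□ (hypercube k) (hypercube l) _ _ _ _ ⟨
    d (hypercube k □ hypercube l) (H.ι a , K.ι b) (H.ι a′ , K.ι b′)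
      ≡⟨ d-≅ (hypercube k □ hypercube l) (hypercube (k + l)) (hypercube-+ k l) _ _ ⟩
    d (hypercube (k + l)) (H.ι a ++ K.ι b) (H.ι a′ ++ K.ι b′) ∎
    where open ≡-Reasoning

-- Semicubes of a product.

Θ-refl : (G : Graph) (e : Edge G) → Θ G e e
Θ-refl G e eq = Graph.E-irrefl G (subst (E G x) (sym x≡y) adj)
  where
  open Edge e
  -- If `Θ` failed, `d G x y + d G y x` would equal `d G x x + d G y y`, which is 0.
  x≡y : x ≡ y
  x≡y = d≡0⇒≡ G (m+n≡0⇒m≡0 (d G x y)
          (trans (sym eq) (cong₂ _+_ (d-refl G x) (d-refl G y))))

-- Each edge lies in its own class, so it may serve as the class representative.
oppositeSemicubes : (G : Graph) → OppositeSemicubeIsomorphic G →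
                    (e : Edge G) → G [ W⁰ G e ] ≅ G [ W¹ G e ]
oppositeSemicubes G (_ , iso) e = iso e e (Θ-refl G e)

module _ (G X : Graph) where

  -- Membership in `S` is decided by the first coordinate, so its proof can be attached there.
  -- Irrelevance of that proof makes both round trips hold by `refl`.
  []-□ˡ : {P : Pred (V G) 0ℓ} {S : Pred (V (G □ X)) 0ℓ} →
          (∀ g h → S (g , h) ⇔ P g) → (G □ X) [ S ] ≅ (G [ P ]) □ₛ simple X
  []-□ˡ S⇔P = record
    { bijection = mk↔ₛ′
        (λ ((g , h) , s) → (g , Irrelevant.map (⇒ (S⇔P g h)) s) , h)
        (λ ((g , p) , h) → (g , h) , Irrelevant.map (⇐ (S⇔P g h)) p)
        (λ _ → refl) (λ _ → refl)
    -- For an edge along `X`, one side equates underlying vertices of `G` and the other equates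
    -- refined ones.
    ; E⇔E       = λ _ _ → ⇔-id _ ⊎-⇔ (mk⇔ value-injective (cong value) ×-⇔ ⇔-id _)
    }

  []-□ʳ : {P : Pred (V X) 0ℓ} {S : Pred (V (G □ X)) 0ℓ} →
          (∀ g h → S (g , h) ⇔ P h) → (G □ X) [ S ] ≅ simple G □ₛ (X [ P ])
  []-□ʳ S⇔P = record
    { bijection = mk↔ₛ′
        (λ ((g , h) , s) → g , (h , Irrelevant.map (⇒ (S⇔P g h)) s))
        (λ (g , (h , p)) → (g , h) , Irrelevant.map (⇐ (S⇔P g h)) p)
        (λ _ → refl) (λ _ → refl)
    ; E⇔E       = λ _ _ → (⇔-id _ ×-⇔ mk⇔ value-injective (cong value)) ⊎-⇔ ⇔-id _
    }

  -- By additivity both distances contain the summand `d X c h`, which cancels.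
  closer-□ˡ : ∀ a b c g h →
    d (G □ X) (a , c) (g , h) < d (G □ X) (b , c) (g , h) ⇔ d G a g < d G b g
  closer-□ˡ a b c g h rewrite d-□ G X a g c h | d-□ G X b g c h =
    mk⇔ (+-cancelʳ-< (d X c h) _ _) (+-monoˡ-< (d X c h))

  closer-□ʳ : ∀ a b c g h →
    d (G □ X) (c , a) (g , h) < d (G □ X) (c , b) (g , h) ⇔ d X a h < d X b h
  closer-□ʳ a b c g h rewrite d-□ G X c g a h | d-□ G X c g b h =
    mk⇔ (+-cancelˡ-< (d G c g) _ _) (+-monoʳ-< (d G c g))

  □-oppositeSemicubes :
    (∀ e → G [ W⁰ G e ] ≅ G [ W¹ G e ]) → (∀ e → X [ W⁰ X e ] ≅ X [ W¹ X e ]) →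
    ∀ e → (G □ X) [ W⁰ (G □ X) e ] ≅ (G □ X) [ W¹ (G □ X) e ]
  □-oppositeSemicubes isoG isoX record { x = a , c ; y = b , .c ; adj = inj₁ (e , refl) } =
    ≅-trans ([]-□ˡ (closer-□ˡ a b c))
      (≅-trans (□ₛ-cong (isoG record { adj = e }) (≅-refl {simple X}))
               -- Interchanging the ends `a` and `b` turns the description of `W⁰` into that of
               -- `W¹`.
               (≅-sym ([]-□ˡ (closer-□ˡ b a c))))
  □-oppositeSemicubes isoG isoX record { x = c , a ; y = .c , b ; adj = inj₂ (refl , e) } =
    ≅-trans ([]-□ʳ (closer-□ʳ a b c))
      (≅-trans (□ₛ-cong (≅-refl {simple G}) (isoX record { adj = e }))
               (≅-sym ([]-□ʳ (closer-□ʳ b a c))))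

lemma4p1 : (G X : Graph) → IsPartialCube G → IsPartialCube X →
    OppositeSemicubeIsomorphic G → OppositeSemicubeIsomorphic X →
    OppositeSemicubeIsomorphic (G □ X)
lemma4p1 G X G-cube X-cube G-iso X-iso =
  □-isPartialCube G X G-cube X-cube ,
  λ _ e _ → □-oppositeSemicubes G X (oppositeSemicubes G G-iso) (oppositeSemicubes X X-iso) e
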